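{- The Chain Prefix Maxgap Problem can be solved in $O(m)$ time using an auxiliary array of size $n$: given pairwise disjoint sets $X_1,\dots,X_k\subseteq\{1,\dots,n\}$ together with the sorted sequence of the elements of $X_1\cup\cdots\cup X_k$, where $m=\sum_i|X_i|$, compute for every $i=1,\dots,k$ the number $$\Delta_i=\max_{j\le i}\ \mathrm{maxgap}(X_j\cup X_{j+1}\cup\cdots\cup X_k).$$
   Context: For a finite set $X$ of integers, $\mathrm{maxgap}(X)$ is the maximum of $b-a$ over consecutive elements $a<b$ of $X$ (consecutive in sorted order), or $0$ if $|X|\le 1$. The input size is $m$.
   Formalization: The time bound is O(max(m,k)) instead of O(m): if empty sets X_i are allowed, k can exceed m (all X_i empty gives m = 0) and writing k numbers in O(m) time is impossible; for k ≤ m, in particular for nonempty sets, the bound is O(m). -}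

module Defs where

open import Data.Bool.Base using (if_then_else_)
open import Data.Fin.Base using (Fin; zero; suc; toℕ)
open import Data.List.Base
  using (List; length; lookup; map; filter; concat; drop; upTo; cartesianProduct)
open import Data.List.Extrema.Nat using (max)
open import Data.List.Relation.Binary.Disjoint.Propositional using (Disjoint)
open import Data.List.Relation.Binary.Permutation.Propositional using (_↭_)
open import Data.List.Relation.Unary.All using (All; all?)
open import Data.List.Relation.Unary.AllPairs using (AllPairs)
open import Data.List.Relation.Unary.Linked using (Linked)
open import Data.List.Relation.Unary.Unique.Propositional using (Unique)
open import Data.Nat.Base using (ℕ; zero; suc; _+_; _∸_; _≤_; _<_; _≡ᵇ_)
open import Data.Nat.Properties using (_≤?_; _<?_)
open import Data.Product.Base using (_×_; _,_; uncurry)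
open import Data.Sum.Base using (_⊎_)
open import Data.Unit.Base using (⊤)
import Data.Vec.Functional as Vector
open import Relation.Binary.PropositionalEquality.Core using (_≡_)
open import Relation.Nullary.Decidable.Core using (Dec; _×-dec_; _⊎-dec_)
open import Relation.Nullary.Negation.Core using (¬_)

------------------------------------------------------------------------
-- Maximum gaps

-- Finite sets are lists; neither the order nor the multiplicity of the
-- entries of X matters in what follows.

Consecutive : List ℕ → ℕ × ℕ → Set
Consecutive X (a , b) = a < b × All (λ c → c ≤ a ⊎ b ≤ c) X

consecutive? : ∀ X p → Dec (Consecutive X p)
consecutive? X (a , b) = a <? b ×-dec all? (λ c → c ≤? a ⊎-dec b ≤? c) X

-- There is no consecutive pair exactly when X has at most one element, and
-- the maximum is then the default value 0.

maxgap : List ℕ → ℕ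
maxgap X =
  max 0 (map (uncurry λ a b → b ∸ a)
             (filter (consecutive? X) (cartesianProduct X X)))

-- Families are indexed from 0: Xs lists X₁,…,X_k, concat (drop j Xs) is
-- X_{j+1} ∪ … ∪ X_k, and Δ Xs i is the number written Δ_{i+1} when counting
-- from 1.

Δ : List (List ℕ) → ℕ → ℕ
Δ Xs i = max 0 (map (λ j → maxgap (concat (drop j Xs))) (upTo (suc i)))

record Instance : Set where
  field
    n             : ℕ
    Xs            : List (List ℕ)
    sorted        : List ℕ
    unique        : All Unique Xs
    inRange       : All (All (λ x → 1 ≤ x × x ≤ n)) Xs
    disjoint      : AllPairs Disjoint Xs
    sorted-↭      : sorted ↭ concat Xs
    sorted-strict : Linked _<_ sorted

  k : ℕ
  k = length Xs

  m : ℕ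
  m = length (concat Xs)

------------------------------------------------------------------------
-- A word RAM with structured control flow and unit-cost operations

-- Registers are named by numbers. A program mentions only finitely many of
-- them, so they provide a constant amount of storage.

Reg : Set
Reg = ℕ

-- The only memory besides the registers: three arrays holding the input
-- (which may be overwritten), the auxiliary array and the output array.

Arr : Set
Arr = Fin 5

pattern elemsᴬ  = zero
pattern sizesᴬ  = suc zero
pattern sortedᴬ = suc (suc zero)
pattern auxᴬ    = suc (suc (suc zero))
pattern outᴬ    = suc (suc (suc (suc zero)))

infixl 6 _⊕_ _⊖_
infix  4 _≺_
infix  3 _≔_ _[_]≔_
infixr 2 _⨟_

data Expr : Set where
  lit     : ℕ → Expr
  reg     : Reg → Expr
  _⊕_ _⊖_ : Expr → Expr → Expr
  _[_]    : Arr → Expr → Expr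

data Test : Set where
  _≺_ : Expr → Expr → Test

data Cmd : Set where
  skip   : Cmd
  _≔_    : Reg → Expr → Cmd
  _[_]≔_ : Arr → Expr → Expr → Cmd
  _⨟_    : Cmd → Cmd → Cmd
  ifᶜ    : Test → Cmd → Cmd → Cmd
  while  : Test → Cmd → Cmd

-- Array a has the cells cell a 0, …, cell a (size a ∸ 1); the values of
-- cell a beyond that are never accessed.

record State : Set where
  field
    regs : Reg → ℕ
    size : Arr → ℕ
    cell : Arr → ℕ → ℕ

open State

update : (ℕ → ℕ) → ℕ → ℕ → ℕ → ℕ
update f i v j = if i ≡ᵇ j then v else f j

setReg : Reg → ℕ → State → State
setReg r v σ = record σ { regs = update (regs σ) r v }

setCell : Arr → ℕ → ℕ → State → State
setCell a i v σ = record σ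
  { cell = Vector.updateAt (cell σ) a (λ f → update f i v) }

⟦_⟧ : Expr → State → ℕ
⟦ lit v   ⟧ σ = v
⟦ reg r   ⟧ σ = regs σ r
⟦ e ⊕ e′  ⟧ σ = ⟦ e ⟧ σ + ⟦ e′ ⟧ σ
⟦ e ⊖ e′  ⟧ σ = ⟦ e ⟧ σ ∸ ⟦ e′ ⟧ σ
⟦ a [ e ] ⟧ σ = cell σ a (⟦ e ⟧ σ)

⟦_⟧ᵗ : Test → State → Set
⟦ e ≺ e′ ⟧ᵗ σ = ⟦ e ⟧ σ < ⟦ e′ ⟧ σ

-- Words hold the numbers 0, …, W. Safe W e σ says that evaluating e neither
-- overflows a word nor reads outside an array; the machine is stuck
-- otherwise.

Safe : ℕ → Expr → State → Set
Safe W (lit v)   σ = v ≤ W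
Safe W (reg r)   σ = ⊤
Safe W (e ⊕ e′)  σ = Safe W e σ × Safe W e′ σ × ⟦ e ⟧ σ + ⟦ e′ ⟧ σ ≤ W
Safe W (e ⊖ e′)  σ = Safe W e σ × Safe W e′ σ
Safe W (a [ e ]) σ = Safe W e σ × ⟦ e ⟧ σ < size σ a

Safeᵗ : ℕ → Test → State → Set
Safeᵗ W (e ≺ e′) σ = Safe W e σ × Safe W e′ σ

cost : Expr → ℕ
cost (lit _)   = 1
cost (reg _)   = 1
cost (e ⊕ e′)  = 1 + (cost e + cost e′)
cost (e ⊖ e′)  = 1 + (cost e + cost e′)
cost (_ [ e ]) = 1 + cost e

costᵗ : Test → ℕ
costᵗ (e ≺ e′) = 1 + (cost e + cost e′)

-- W ⊢ P ∶ σ ⇓[ t ] σ′: on words up to W, the program P started in σ halts in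
-- σ′ after t steps.

infix 1 _⊢_∶_⇓[_]_

data _⊢_∶_⇓[_]_ (W : ℕ) : Cmd → State → ℕ → State → Set where

  ⇓skip : ∀ {σ} → W ⊢ skip ∶ σ ⇓[ 1 ] σ

  ⇓assign : ∀ {σ r e} → Safe W e σ →
    W ⊢ (r ≔ e) ∶ σ ⇓[ 1 + cost e ] setReg r (⟦ e ⟧ σ) σ

  ⇓store : ∀ {σ a e e′} → Safe W e σ → Safe W e′ σ → ⟦ e ⟧ σ < size σ a →
    W ⊢ (a [ e ]≔ e′) ∶ σ ⇓[ 1 + (cost e + cost e′) ]
      setCell a (⟦ e ⟧ σ) (⟦ e′ ⟧ σ) σ

  ⇓seq : ∀ {σ σ′ σ″ P Q t t′} →
    W ⊢ P ∶ σ ⇓[ t ] σ′ → W ⊢ Q ∶ σ′ ⇓[ t′ ] σ″ →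
    W ⊢ (P ⨟ Q) ∶ σ ⇓[ t + t′ ] σ″

  ⇓then : ∀ {σ σ′ b P Q t} → Safeᵗ W b σ → ⟦ b ⟧ᵗ σ →
    W ⊢ P ∶ σ ⇓[ t ] σ′ →
    W ⊢ ifᶜ b P Q ∶ σ ⇓[ costᵗ b + t ] σ′

  ⇓else : ∀ {σ σ′ b P Q t} → Safeᵗ W b σ → ¬ ⟦ b ⟧ᵗ σ →
    W ⊢ Q ∶ σ ⇓[ t ] σ′ →
    W ⊢ ifᶜ b P Q ∶ σ ⇓[ costᵗ b + t ] σ′

  ⇓stop : ∀ {σ b P} → Safeᵗ W b σ → ¬ ⟦ b ⟧ᵗ σ →
    W ⊢ while b P ∶ σ ⇓[ costᵗ b ] σ

  ⇓loop : ∀ {σ σ′ σ″ b P t t′} → Safeᵗ W b σ → ⟦ b ⟧ᵗ σ →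
    W ⊢ P ∶ σ ⇓[ t ] σ′ → W ⊢ while b P ∶ σ′ ⇓[ t′ ] σ″ →
    W ⊢ while b P ∶ σ ⇓[ costᵗ b + (t + t′) ] σ″

------------------------------------------------------------------------
-- Input and output

Holds : State → Arr → List ℕ → Set
Holds σ a xs =
  size σ a ≡ length xs × (∀ i → cell σ a (toℕ i) ≡ lookup xs i)

-- The sets arrive as one array with the elements of X₁, then those of X₂, and
-- so on, each set in arbitrary order, and one array with |X₁|,…,|X_k|.
-- Nothing is assumed about the initial contents of the auxiliary array, the
-- output array and the registers other than 0, 1 and 2; in particular the
-- auxiliary array is not cleared, which would take time n.

record Initial (I : Instance) (σ : State) : Set where
  open Instance I
  field
    reg-n     : regs σ 0 ≡ n
    reg-m     : regs σ 1 ≡ m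
    reg-k     : regs σ 2 ≡ k
    in-elems  : Holds σ elemsᴬ (concat Xs)
    in-sizes  : Holds σ sizesᴬ (map length Xs)
    in-sorted : Holds σ sortedᴬ sorted
    aux-size  : size σ auxᴬ ≡ n
    out-size  : size σ outᴬ ≡ k

Output : Instance → State → Set
Output I σ = Holds σ outᴬ (map (Δ Xs) (upTo k))
  where open Instance I

{-# OPTIONS --safe #-}
module Submission where

-- Label every element with the index s of its set, in the auxiliary array.
-- A pair a < b is consecutive in X_j ∪ … ∪ X_k exactly when
--   s c < j ≤ min (s a) (s b)  for all elements c strictly between a and b,
-- so b − a contributes to Δ_i for all i from the least such j on. The minimal
-- levels of all pairs are found by one scan of the sorted sequence with a stack
-- whose labels decrease towards the top: before b is pushed it meets the top a,
-- b − a is recorded at level lo = 1 + (largest label in between), and a is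
-- popped if s a ≤ s b. The answer is the sequence of prefix maxima of the
-- recorded values.

open import Defs
open import Data.Nat.Base using (ℕ; suc; _+_; _*_; _⊔_; _≤_)
open import Data.Product.Base using (_×_; ∃-syntax)
open Instance using (n; m; k)

open import Data.Bool.Base using (true; false; T)
open import Data.Fin.Base as Fin using (toℕ)
open import Data.Fin.Properties using (toℕ<n)
open import Data.List.Base
  using (List; []; _∷_; _++_; length; lookup; map; concat; drop; applyUpTo)
open import Data.List.Extrema.Nat using (max≤v⁺; v≤max⁺)
open import Data.List.Membership.Propositional using (_∈_; _∉_)
open import Data.List.Membership.DecPropositional using (_∈?_)
open import Data.List.Membership.Propositional.Properties
  using (∈-++⁺ˡ; ∈-++⁺ʳ; ∈-++⁻; ∈-map⁺; ∈-filter⁺; ∈-filter⁻;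
         ∈-cartesianProduct⁺; ∈-cartesianProduct⁻; ∈-upTo⁺; ∈-upTo⁻)
open import Data.List.Properties
  using (length-map; map-upTo; length-applyUpTo; lookup-applyUpTo)
open import Data.List.Relation.Binary.Disjoint.Propositional using (Disjoint)
open import Data.List.Relation.Binary.Disjoint.Propositional.Properties using (concat⁺ʳ)
open import Data.List.Relation.Binary.Permutation.Propositional using (↭-sym)
open import Data.List.Relation.Binary.Permutation.Propositional.Properties
  using (∈-resp-↭; ↭-length)
open import Data.List.Relation.Unary.All as All using (All; []; _∷_)
import Data.List.Relation.Unary.All.Properties as All
open import Data.List.Relation.Unary.AllPairs using (AllPairs; []; _∷_)
open import Data.List.Relation.Unary.Any as Any using (here; there)
open import Data.List.Relation.Unary.Linked.Properties using (Linked⇒AllPairs)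
open import Data.Nat.Base using (zero; _∸_; _<_; _≡ᵇ_; z≤n; s≤s; z<s)
open import Data.Nat.Properties
open import Data.Product.Base using (_,_; proj₁; proj₂)
open import Data.Sum.Base using (_⊎_; inj₁; inj₂; [_,_]′)
open import Data.Unit.Base using (⊤; tt)
open import Function.Base using (_∘_)
open import Relation.Binary.PropositionalEquality
  using (_≡_; _≢_; refl; sym; trans; cong; cong₂; subst)
open import Relation.Nullary.Decidable.Core using (Dec; yes; no)
open import Relation.Nullary.Negation.Core using (¬_; contradiction)

open State

-- Total correctness with running time

-- Both branches of a conditional are added up, and a loop is charged for one test and one pass.
-- Repetitions are left to a separate factor, so that this number depends on the program alone.
steps : Cmd → ℕ
steps skip           = 1
steps (r ≔ e)        = 1 + cost e
steps (a [ e ]≔ e′)  = 1 + (cost e + cost e′)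
steps (P ⨟ Q)        = steps P + steps Q
steps (ifᶜ b P Q)    = costᵗ b + (steps P + steps Q)
steps (while b P)    = costᵗ b + steps P

-- N bounds the number of iterations of every loop of P; loop bodies are
-- themselves free of loops and are run with N = 0.
record Runs (W N : ℕ) (P : Cmd) (Q : State → Set) (σ : State) : Set where
  constructor runs
  field
    {time}  : ℕ
    {final} : State
    halts   : W ⊢ P ∶ σ ⇓[ time ] final
    bounded : time ≤ steps P * suc N
    post    : Q final

module _ {W N : ℕ} where

  run-skip : ∀ {Q σ} → Q σ → Runs W N skip Q σ
  run-skip q = runs ⇓skip (s≤s z≤n) q

  run-assign : ∀ {Q σ r e} → Safe W e σ → Q (setReg r (⟦ e ⟧ σ) σ) → Runs W N (r ≔ e) Q σ
  run-assign s q = runs (⇓assign s) (m≤m*n _ _) q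

  run-store : ∀ {Q σ a e e′} → Safe W e σ → Safe W e′ σ → ⟦ e ⟧ σ < size σ a →
    Q (setCell a (⟦ e ⟧ σ) (⟦ e′ ⟧ σ) σ) → Runs W N (a [ e ]≔ e′) Q σ
  run-store s s′ e< q = runs (⇓store s s′ e<) (m≤m*n _ _) q

  run-seq : ∀ {P P′ R σ} → Runs W N P (Runs W N P′ R) σ → Runs W N (P ⨟ P′) R σ
  run-seq {P} (runs p p≤ (runs p′ p′≤ r)) = runs (⇓seq p p′)
    (≤-trans (+-mono-≤ p≤ p′≤) (≤-reflexive (sym (*-distribʳ-+ (suc N) (steps P) _)))) r

  run-then : ∀ {b P P′ Q σ} → Safeᵗ W b σ → ⟦ b ⟧ᵗ σ → Runs W N P Q σ →
    Runs W N (ifᶜ b P P′) Q σ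
  run-then {b} {P} {P′} s t (runs p p≤ q) = runs (⇓then s t p)
    (≤-trans (+-mono-≤ (m≤m*n (costᵗ b) (suc N)) (≤-trans p≤ (*-monoˡ-≤ (suc N) (m≤m+n (steps P) (steps P′)))))
      (≤-reflexive (sym (*-distribʳ-+ (suc N) (costᵗ b) _)))) q

  run-else : ∀ {b P P′ Q σ} → Safeᵗ W b σ → ¬ ⟦ b ⟧ᵗ σ → Runs W N P′ Q σ →
    Runs W N (ifᶜ b P P′) Q σ
  run-else {b} {P} {P′} s t (runs p p≤ q) = runs (⇓else s t p)
    (≤-trans (+-mono-≤ (m≤m*n (costᵗ b) (suc N)) (≤-trans p≤ (*-monoˡ-≤ (suc N) (m≤n+m (steps P′) (steps P)))))
      (≤-reflexive (sym (*-distribʳ-+ (suc N) (costᵗ b) _)))) q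

  weaken : ∀ {P Q R σ} → (∀ {σ′} → Q σ′ → R σ′) → Runs W N P Q σ → Runs W N P R σ
  weaken f (runs p p≤ q) = runs p p≤ (f q)

-- A turn at measure 0 can only stop, so an invariant that always offers a turn carries its own
-- termination proof.
data Turn (W : ℕ) (b : Test) (P : Cmd) (Inv : ℕ → State → Set) (Q : State → Set) :
          ℕ → State → Set where
  stop : ∀ {μ σ} → Safeᵗ W b σ → ¬ ⟦ b ⟧ᵗ σ → Q σ → Turn W b P Inv Q μ σ
  next : ∀ {μ σ} → Safeᵗ W b σ → ⟦ b ⟧ᵗ σ → Runs W 0 P (Inv μ) σ → Turn W b P Inv Q (suc μ) σ

-- From measure `μ` there are at most `μ` passes and one final test, each charged
-- `costᵗ b + steps P`, since a body run with `N = 0` takes at most `steps P` steps.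
run-while : ∀ {W N b P} {Q : State → Set} (Inv : ℕ → State → Set) →
  (∀ {μ σ} → Inv μ σ → Turn W b P Inv Q μ σ) →
  ∀ {μ σ} → μ ≤ N → Inv μ σ → Runs W N (while b P) Q σ
run-while {W} {N} {b} {P} {Q} Inv turn μ≤N inv =
  let t , σ′ , d , t≤ , q = go _ inv
  in runs d (≤-trans t≤ (≤-trans (≤-reflexive (*-comm (suc _) K)) (*-monoʳ-≤ K (s≤s μ≤N)))) q
  where
  K = costᵗ b + steps P
  go : ∀ μ {σ} → Inv μ σ → ∃[ t ] ∃[ σ′ ] (W ⊢ while b P ∶ σ ⇓[ t ] σ′) × t ≤ suc μ * K × Q σ′
  go μ inv with turn inv
  go μ inv | stop s ¬t q =
    _ , _ , ⇓stop s ¬t , ≤-trans (m≤m+n (costᵗ b) (steps P)) (m≤m+n K (μ * K)) , q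
  go (suc μ) inv | next s t (runs p p≤ inv′) with t′ , σ′ , d , t′≤ , q ← go μ inv′ =
    _ , _ , ⇓loop s t p d ,
    ≤-trans (≤-reflexive (sym (+-assoc (costᵗ b) _ t′)))
      (+-mono-≤ (+-monoʳ-≤ (costᵗ b) (≤-trans p≤ (≤-reflexive (*-identityʳ _)))) t′≤) , q

-- Array updates, segments and stacks

≡ᵇ-refl : ∀ i → (i ≡ᵇ i) ≡ true
≡ᵇ-refl zero    = refl
≡ᵇ-refl (suc i) = ≡ᵇ-refl i

update-≡ : ∀ f i v → update f i v i ≡ v
update-≡ f i v rewrite ≡ᵇ-refl i = refl

update-≢ : ∀ f {i} v {j} → i ≢ j → update f i v j ≡ f j
update-≢ f {i} v {j} i≢j with i ≡ᵇ j in eq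
... | true  = contradiction (≡ᵇ⇒≡ i j (subst T (sym eq) tt)) i≢j
... | false = refl

infixr 5 _∷_
data Segment (f : ℕ → ℕ) : ℕ → List ℕ → Set where
  []  : ∀ {p} → Segment f p []
  _∷_ : ∀ {p x xs} → f p ≡ x → Segment f (suc p) xs → Segment f p (x ∷ xs)

segment-update : ∀ {f q v p xs} → q < p → Segment f p xs → Segment (update f q v) p xs
segment-update q<p []        = []
segment-update {f} q<p (eq ∷ fs) =
  trans (update-≢ f _ (<⇒≢ q<p)) eq ∷ segment-update (m<n⇒m<1+n q<p) fs

lookup⇒segment : ∀ f p xs → (∀ i → f (p + toℕ i) ≡ lookup xs i) → Segment f p xs
lookup⇒segment f p []       eq = []
lookup⇒segment f p (x ∷ xs) eq =
  trans (cong f (sym (+-identityʳ p))) (eq Fin.zero) ∷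
  lookup⇒segment f (suc p) xs λ i → trans (cong f (sym (+-suc p (toℕ i)))) (eq (Fin.suc i))

-- The head of the list is the top. Since the empty list demands `p ≡ 0`, `p` is the height, and
-- comparing it with 0 decides emptiness.
Stack : (ℕ → ℕ) → ℕ → List ℕ → Set
Stack f p []       = p ≡ 0
Stack f p (x ∷ xs) = 0 < p × f (p ∸ 1) ≡ x × Stack f (p ∸ 1) xs

stack-update : ∀ {f q v p} xs → p ≤ q → Stack f p xs → Stack (update f q v) p xs
stack-update []       p≤q p≡0 = p≡0
stack-update {f} {p = suc p} (x ∷ xs) p≤q (0<p , eq , fs) =
  0<p , trans (update-≢ f _ (>⇒≢ p≤q)) eq , stack-update xs (<⇒≤ p≤q) fs

-- Labelling elements by the index of their set

Labelled : (ℕ → ℕ) → ℕ → List (List ℕ) → Set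
Labelled s i []       = ⊤
Labelled s i (Z ∷ Zs) = All (λ x → s x ≡ i) Z × Labelled s (suc i) Zs

labelled-cong : ∀ {s s′} i Zs → (∀ {x} → x ∈ concat Zs → s′ x ≡ s x) →
  Labelled s i Zs → Labelled s′ i Zs
labelled-cong i []       eq _        = _
labelled-cong i (Z ∷ Zs) eq (sZ , l) =
  All.tabulate (λ x∈Z → trans (eq (∈-++⁺ˡ x∈Z)) (All.lookup sZ x∈Z)) ,
  labelled-cong (suc i) Zs (eq ∘ ∈-++⁺ʳ Z) l

labelled-drop : ∀ {s} i j Zs → Labelled s i Zs → Labelled s (j + i) (drop j Zs)
labelled-drop i zero    Zs       l       = l
labelled-drop i (suc j) []       l       = _
labelled-drop {s} i (suc j) (Z ∷ Zs) (_ , l) =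
  subst (λ i′ → Labelled s i′ (drop j Zs)) (+-suc j i) (labelled-drop (suc i) j Zs l)

labelled-≥ : ∀ {s} i Zs {x} → Labelled s i Zs → x ∈ concat Zs → i ≤ s x
labelled-≥ i (Z ∷ Zs) (sZ , l) x∈ with ∈-++⁻ Z x∈
... | inj₁ x∈Z  = ≤-reflexive (sym (All.lookup sZ x∈Z))
... | inj₂ x∈Zs = <⇒≤ (labelled-≥ (suc i) Zs l x∈Zs)

labelled-< : ∀ {s} i Zs {x} → Labelled s i Zs → x ∈ concat Zs → s x < i + length Zs
labelled-< {s} i (Z ∷ Zs) {x} (sZ , l) x∈ with ∈-++⁻ Z x∈
... | inj₁ x∈Z  = subst (_< i + suc (length Zs)) (sym (All.lookup sZ x∈Z)) (m<m+n i z<s)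
... | inj₂ x∈Zs = subst (s x <_) (sym (+-suc i (length Zs))) (labelled-< (suc i) Zs l x∈Zs)

∈-drop⁻ : ∀ j Zs {x : ℕ} → x ∈ concat (drop j Zs) → x ∈ concat Zs
∈-drop⁻ zero    Zs       x∈ = x∈
∈-drop⁻ (suc j) (Z ∷ Zs) x∈ = ∈-++⁺ʳ Z (∈-drop⁻ j Zs x∈)

∈-drop⁺ : ∀ {s} i j Zs {x} → Labelled s i Zs → x ∈ concat Zs → j + i ≤ s x →
  x ∈ concat (drop j Zs)
∈-drop⁺ i zero    Zs       l        x∈ j≤ = x∈
∈-drop⁺ {s} i (suc j) (Z ∷ Zs) {x} (sZ , l) x∈ j≤ with ∈-++⁻ Z x∈
... | inj₁ x∈Z  = contradiction (subst (suc (j + i) ≤_) (All.lookup sZ x∈Z) j≤) (<⇒≱ (s≤s (m≤n+m i j)))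
... | inj₂ x∈Zs = ∈-drop⁺ (suc i) j Zs l x∈Zs (subst (_≤ s x) (sym (+-suc j i)) j≤)

label : ℕ → List (List ℕ) → ℕ → ℕ
label i []       x = i
label i (X ∷ Xs) x with _∈?_ _≟_ x X
... | yes _ = i
... | no  _ = label (suc i) Xs x

label-∈ : ∀ i X Xs {x} → x ∈ X → label i (X ∷ Xs) x ≡ i
label-∈ i X Xs {x} x∈X with _∈?_ _≟_ x X
... | yes _   = refl
... | no  x∉X = contradiction x∈X x∉X

label-∉ : ∀ i X Xs {x} → x ∉ X → label i (X ∷ Xs) x ≡ label (suc i) Xs x
label-∉ i X Xs {x} x∉X with _∈?_ _≟_ x X
... | yes x∈X = contradiction x∈X x∉X
... | no  _   = refl

-- Disjointness makes the first set containing an element the only one, so the search passes over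
-- all earlier sets.
label-labelled : ∀ i {Xs} → AllPairs Disjoint Xs → Labelled (label i Xs) i Xs
label-labelled i []                      = _
label-labelled i {X ∷ Xs} (X#Xs ∷ #Xs) =
  All.tabulate (label-∈ i X Xs) ,
  labelled-cong (suc i) Xs
    (λ x∈Xs → label-∉ i X Xs λ x∈X → concat⁺ʳ X#Xs (x∈X , x∈Xs))
    (label-labelled (suc i) #Xs)

-- Gaps and prefix maxima

consecutive⇒≤maxgap : ∀ {X a b} → a ∈ X → b ∈ X → Consecutive X (a , b) → b ∸ a ≤ maxgap X
consecutive⇒≤maxgap {X} a∈ b∈ ab = v≤max⁺ 0 _ (inj₂ (Any.map ≤-reflexive
  (∈-map⁺ _ (∈-filter⁺ (consecutive? X) (∈-cartesianProduct⁺ a∈ b∈) ab))))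

maxgap≤ : ∀ {X v} → (∀ {a b} → a ∈ X → b ∈ X → Consecutive X (a , b) → b ∸ a ≤ v) →
  maxgap X ≤ v
maxgap≤ {X} h = max≤v⁺ z≤n (All.map⁺ (All.tabulate λ p∈ →
  let p∈X×X , ab = ∈-filter⁻ (consecutive? X) p∈
      a∈ , b∈ = ∈-cartesianProduct⁻ X X p∈X×X
  in h a∈ b∈ ab))

-- The range is half-open, so `Δ Xs i` will be matched with the argument `suc i`.
prefixMax : (ℕ → ℕ) → ℕ → ℕ
prefixMax f zero    = 0
prefixMax f (suc i) = prefixMax f i ⊔ f i

≤prefixMax : ∀ f {i j} → j < i → f j ≤ prefixMax f i
≤prefixMax f {suc i} {j} (s≤s j≤i) with m≤n⇒m<n∨m≡n j≤i
... | inj₁ j<i  = ≤-trans (≤prefixMax f j<i) (m≤m⊔n _ _)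
... | inj₂ refl = m≤n⊔m (prefixMax f j) _

prefixMax≤ : ∀ f i {v} → (∀ {j} → j < i → f j ≤ v) → prefixMax f i ≤ v
prefixMax≤ f zero    h = z≤n
prefixMax≤ f (suc i) h = ⊔-lub (prefixMax≤ f i (h ∘ m<n⇒m<1+n)) (h ≤-refl)

-- Adjacent pairs by level and the invariant of the stack

module Gaps (Xs : List (List ℕ)) (s : ℕ → ℕ) where

  Y : ℕ → List ℕ
  Y j = concat (drop j Xs)

  -- Consecutiveness in `Y j` expressed by labels: for a correct labelling, belonging to `Y j` means
  -- having a label of at least `j`.
  record Adjacent (j a b : ℕ) : Set where
    field
      left∈   : a ∈ concat Xs
      right∈  : b ∈ concat Xs
      ≤left   : j ≤ s a
      ≤right  : j ≤ s b
      ordered : a < b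
      between : ∀ {c} → c ∈ concat Xs → a < c → c < b → s c < j

  -- A lower level suffices because the prefix maxima carry a recorded value to all higher ones.
  Covered : (ℕ → ℕ) → ℕ → ℕ → Set
  Covered out j d = ∃[ i ] i ≤ j × d ≤ out i

  covered-mono : ∀ {out out′ j d} → (∀ i → out i ≤ out′ i) → Covered out j d → Covered out′ j d
  covered-mono ≤out′ (i , i≤j , d≤) = i , i≤j , ≤-trans d≤ (≤out′ i)

  module _ (labelled : Labelled s 0 Xs) where

    ∈Y⇒≤label : ∀ j {x} → x ∈ Y j → j ≤ s x
    ∈Y⇒≤label j x∈ = subst (_≤ _) (+-identityʳ j)
      (labelled-≥ _ (drop j Xs) (labelled-drop 0 j Xs labelled) x∈)

    ≤label⇒∈Y : ∀ j {x} → x ∈ concat Xs → j ≤ s x → x ∈ Y j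
    ≤label⇒∈Y j x∈ j≤ = ∈-drop⁺ 0 j Xs labelled x∈ (subst (_≤ _) (sym (+-identityʳ j)) j≤)

    adjacent⇒≤maxgap : ∀ {j a b} → Adjacent j a b → b ∸ a ≤ maxgap (Y j)
    adjacent⇒≤maxgap {j} {a} {b} adj = consecutive⇒≤maxgap
      (≤label⇒∈Y j left∈ ≤left) (≤label⇒∈Y j right∈ ≤right) (ordered , All.tabulate outside)
      where
      open Adjacent adj
      outside : ∀ {c} → c ∈ Y j → c ≤ a ⊎ b ≤ c
      outside {c} c∈ with c ≤? a | b ≤? c
      ... | yes c≤a | _       = inj₁ c≤a
      ... | no  _   | yes b≤c = inj₂ b≤c
      ... | no  c≰a | no  b≰c = contradiction (∈Y⇒≤label j c∈)
        (<⇒≱ (between (∈-drop⁻ j Xs c∈) (≰⇒> c≰a) (≰⇒> b≰c)))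

    maxgap≤-adjacent : ∀ {j v} → (∀ {a b} → Adjacent j a b → b ∸ a ≤ v) → maxgap (Y j) ≤ v
    maxgap≤-adjacent {j} h = maxgap≤ λ a∈ b∈ (a<b , outside) → h record
      { left∈   = ∈-drop⁻ j Xs a∈
      ; right∈  = ∈-drop⁻ j Xs b∈
      ; ≤left   = ∈Y⇒≤label j a∈
      ; ≤right  = ∈Y⇒≤label j b∈
      ; ordered = a<b
      ; between = λ c∈ a<c c<b → ≰⇒> λ j≤c →
          [ <⇒≱ a<c , <⇒≱ c<b ]′ (All.lookup outside (≤label⇒∈Y j c∈ j≤c))
      }

    -- `out j` need not equal `maxgap (Y j)`. Staying below it prevents overshooting, while each gap
    -- of a level `j ≤ i` is reached by a value recorded at some level up to `j`, inside the same
    -- prefix.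
    prefixMax≡Δ : ∀ {out i} →
      (∀ {j} → j ≤ i → out j ≤ maxgap (Y j)) →
      (∀ {j a b} → Adjacent j a b → Covered out j (b ∸ a)) →
      prefixMax out (suc i) ≡ Δ Xs i
    prefixMax≡Δ {out} {i} sound complete = ≤-antisym
      (prefixMax≤ out (suc i) λ j<1+i → v≤max⁺ 0 _ (inj₂ (Any.map
        (≤-trans (sound (≤-pred j<1+i)) ∘ ≤-reflexive) (∈-map⁺ _ (∈-upTo⁺ j<1+i)))))
      (max≤v⁺ z≤n (All.map⁺ (All.tabulate λ j∈ → maxgap≤-adjacent λ adj →
        let _ , i′≤j , d≤ = complete adj
        in ≤-trans d≤ (≤prefixMax out (≤-<-trans i′≤j (∈-upTo⁻ j∈))))))

  -- lo is one more than the largest label strictly between the top of the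
  -- stack and the next element, or 0 if there is nothing in between.
  Staircase : List ℕ → ℕ → List ℕ → Set
  Staircase pre lo []       = ⊤
  Staircase pre lo (a ∷ st) =
    a ∈ pre × lo ≤ s a × All (_< a) st ×
    (∀ {c} → c ∈ pre → a < c → s c < lo) × Staircase pre (suc (s a)) st

  -- Among the elements read so far, `a` is the largest of level `j`, hence the only possible left
  -- partner of the next element at that level.
  record Visible (pre : List ℕ) (j a : ℕ) : Set where
    constructor visible
    field
      seen   : a ∈ pre
      ≤label : j ≤ s a
      hidden : ∀ {c} → c ∈ pre → a < c → s c < j

  -- At levels up to `s b`, a gap not yet covered has its left end on the stack and a level of at
  -- least `lo`. At levels above `s b`, `b` hides nothing, so the visible elements must survive for
  -- later partners.
  record Pending (pre st : List ℕ) (lo b : ℕ) (out : ℕ → ℕ) : Set where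
    field
      lo≤     : lo ≤ suc (s b)
      kept    : ∀ {j a} → Visible pre j a → s b < j → a ∈ st
      pending : ∀ {j a} → Visible pre j a → j ≤ s b → Covered out j (b ∸ a) ⊎ (a ∈ st × lo ≤ j)

  Current : List ℕ → List ℕ → ℕ → List ℕ → (ℕ → ℕ) → Set
  Current pre st lo []      out = ⊤
  Current pre st lo (b ∷ _) out = Pending pre st lo b out

  record Scan (pre st : List ℕ) (lo : ℕ) (rest : List ℕ) (out : ℕ → ℕ) : Set where
    field
      pre⊆      : ∀ {x} → x ∈ pre → x ∈ concat Xs
      rest⊆     : ∀ {x} → x ∈ rest → x ∈ concat Xs
      split     : ∀ {x} → x ∈ concat Xs → x ∈ pre ⊎ x ∈ rest
      pre<rest  : ∀ {a b} → a ∈ pre → b ∈ rest → a < b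
      ascending : AllPairs _<_ rest
      staircase : Staircase pre lo st
      sound     : ∀ {j} → j < length Xs → out j ≤ maxgap (Y j)
      settled   : ∀ {j a b} → b ∈ pre → Adjacent j a b → Covered out j (b ∸ a)
      current   : Current pre st lo rest out

  scan-start : ∀ {S out} → (∀ {x} → x ∈ S → x ∈ concat Xs) → (∀ {x} → x ∈ concat Xs → x ∈ S) →
    AllPairs _<_ S → (∀ {j} → j < length Xs → out j ≡ 0) → Scan [] [] 0 S out
  scan-start {S} S⊆ S⊇ S< out≡0 = record
    { pre⊆      = λ ()
    ; rest⊆     = S⊆
    ; split     = inj₂ ∘ S⊇
    ; pre<rest  = λ ()
    ; ascending = S<
    ; staircase = _
    ; sound     = λ j<k → ≤-trans (≤-reflexive (out≡0 j<k)) z≤n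
    ; settled   = λ ()
    ; current   = start S
    }
    where
    start : ∀ S {out} → Current [] [] 0 S out
    start []      = _
    start (b ∷ _) = record
      { lo≤     = z≤n
      ; kept    = λ ()
      ; pending = λ ()
      }

  staircase⊆ : ∀ {pre lo} st → Staircase pre lo st → All (_∈ pre) st
  staircase⊆ []       _                     = []
  staircase⊆ (a ∷ st) (a∈ , _ , _ , _ , sc) = a∈ ∷ staircase⊆ st sc

  -- The bounds grow down the stack, so a label below the first bound is below all of them.
  staircase-∷ : ∀ {pre lo b} st → s b < lo → Staircase pre lo st → Staircase (b ∷ pre) lo st
  staircase-∷ []       b<lo _ = _
  staircase-∷ (a ∷ st) b<lo (a∈ , lo≤a , st<a , c<lo , sc) =
    there a∈ , lo≤a , st<a ,
    (λ { (here refl) _ → b<lo ; (there c∈) a<c → c<lo c∈ a<c }) ,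
    staircase-∷ st (<-≤-trans b<lo (m≤n⇒m≤1+n lo≤a)) sc

  staircase-raise : ∀ {pre lo lo′} st → lo ≤ lo′ → All (λ a → lo′ ≤ s a) st →
    Staircase pre lo st → Staircase pre lo′ st
  staircase-raise []       _    _            _ = _
  staircase-raise (a ∷ st) lo≤ (lo′≤a ∷ _) (a∈ , _ , st<a , c<lo , sc) =
    a∈ , lo′≤a , st<a , (λ c∈ a<c → <-≤-trans (c<lo c∈ a<c) lo≤) , sc

  staircase-labels : ∀ {pre lo} st → Staircase pre lo st → All (λ a → lo ≤ s a) st
  staircase-labels []       _                          = []
  staircase-labels (a ∷ st) (_ , lo≤a , _ , _ , sc) =
    lo≤a ∷ All.map (≤-trans (m≤n⇒m≤1+n lo≤a)) (staircase-labels st sc)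

  -- The common core of the three ways to push. Once `b` is read, anything else that is visible has
  -- a level above `s b`, so `kept` finds it on the stack. The bound restarts at 0 because nothing
  -- lies between `b` and its successor.
  scan-push : ∀ {pre st lo b bs out} → Scan pre st lo (b ∷ bs) out →
    All (λ a → s b < s a) st →
    (∀ {j a} → Visible pre j a → j ≤ s b → Covered out j (b ∸ a)) →
    Scan (b ∷ pre) (b ∷ st) 0 bs out
  scan-push {pre} {st} {lo} {b} {bs} {out} sc b<st covered = record
    { pre⊆      = λ { (here refl) → rest⊆ (here refl) ; (there x∈) → pre⊆ x∈ }
    ; rest⊆     = rest⊆ ∘ there
    ; split     = split′ ∘ split
    ; pre<rest  = λ { (here refl) y∈ → All.lookup b<bs y∈ ; (there x∈) y∈ → pre<rest x∈ (there y∈) }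
    ; ascending = bs<
    ; staircase = here refl , z≤n , All.map (λ a∈ → pre<rest a∈ (here refl)) (staircase⊆ st staircase) ,
        (λ { (here refl) b<c → contradiction b<c (<-irrefl refl)
           ; (there c∈)  b<c → contradiction b<c (<-asym (pre<rest c∈ (here refl))) }) ,
        -- Below the new top the bound becomes `suc (s b)`: `lo≤` and `b<st` allow raising it, and
        -- `b` itself stays under it.
        staircase-∷ st ≤-refl (staircase-raise st lo≤ b<st staircase)
    ; sound     = sound
    ; settled   = settled′
    ; current   = current′ bs
    }
    where
    open Scan sc
    open Pending current
    b<bs : All (b <_) bs
    b<bs with b<bs ∷ _ ← ascending = b<bs
    bs< : AllPairs _<_ bs
    bs< with _ ∷ bs< ← ascending = bs<
    split′ : ∀ {x} → x ∈ pre ⊎ x ∈ b ∷ bs → x ∈ b ∷ pre ⊎ x ∈ bs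
    split′ (inj₁ x∈)          = inj₁ (there x∈)
    split′ (inj₂ (here refl)) = inj₁ (here refl)
    split′ (inj₂ (there x∈))  = inj₂ x∈
    before : ∀ {x} → x ∈ concat Xs → x < b → x ∈ pre
    before x∈ x<b with split x∈
    ... | inj₁ x∈pre        = x∈pre
    ... | inj₂ (here refl)  = contradiction x<b (<-irrefl refl)
    ... | inj₂ (there x∈bs) = contradiction x<b (<-asym (All.lookup b<bs x∈bs))
    settled′ : ∀ {j x y} → y ∈ b ∷ pre → Adjacent j x y → Covered out j (y ∸ x)
    settled′ (there y∈)  adj = settled y∈ adj
    -- The left end is visible because every larger element read so far lies strictly between it and
    -- `b`.
    settled′ (here refl) adj = covered (visible (before left∈ ordered) ≤left
      λ c∈ x<c → between (pre⊆ c∈) x<c (pre<rest c∈ (here refl))) ≤right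
      where open Adjacent adj
    all-kept : ∀ {j a} → Visible (b ∷ pre) j a → a ∈ b ∷ st
    all-kept (visible (here refl) _   _)      = here refl
    all-kept (visible (there a∈)  j≤a hidden) = there (kept (visible a∈ j≤a (hidden ∘ there))
      (hidden (here refl) (pre<rest a∈ (here refl))))
    current′ : ∀ bs → Current (b ∷ pre) (b ∷ st) 0 bs out
    current′ []      = _
    current′ (_ ∷ _) = record
      { lo≤     = z≤n
      ; kept    = λ v _ → all-kept v
      ; pending = λ v _ → inj₂ (all-kept v , z≤n)
      }

  -- With nothing on the stack, every pending gap must already be covered.
  scan-push-[] : ∀ {pre lo b bs out} → Scan pre [] lo (b ∷ bs) out →
    Scan (b ∷ pre) (b ∷ []) 0 bs out
  scan-push-[] {pre} {lo} {b} {out = out} sc = scan-push sc [] λ v j≤b → covered (pending v j≤b)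
    where
    open Pending (Scan.current sc)
    covered : ∀ {j a} → Covered out j (b ∸ a) ⊎ (a ∈ [] × lo ≤ j) → Covered out j (b ∸ a)
    covered (inj₁ cov) = cov

  -- Uncovered gaps have levels from `lo` on, which are all above `s b`, and the stack labels are at
  -- least `lo`; so `b` meets no further element.
  scan-push-lo : ∀ {pre st lo b bs out} → Scan pre st lo (b ∷ bs) out → s b < lo →
    Scan (b ∷ pre) (b ∷ st) 0 bs out
  scan-push-lo {pre} {st} {lo} {b} {out = out} sc b<lo =
    scan-push sc (All.map (<-≤-trans b<lo) (staircase-labels st staircase))
      λ v j≤b → covered j≤b (pending v j≤b)
    where
    open Scan sc
    open Pending current
    covered : ∀ {j a} → j ≤ s b → Covered out j (b ∸ a) ⊎ (a ∈ st × lo ≤ j) → Covered out j (b ∸ a)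
    covered _   (inj₁ cov)        = cov
    covered j≤b (inj₂ (_ , lo≤j)) = contradiction (≤-trans lo≤j j≤b) (<⇒≱ b<lo)

  scan-record : ∀ {pre st lo rest out out′} → (∀ j → out j ≤ out′ j) →
    (∀ {j} → j < length Xs → out′ j ≤ maxgap (Y j)) →
    Scan pre st lo rest out → Scan pre st lo rest out′
  scan-record {pre} {st} {lo} {rest} {out} {out′} ≤out′ sound′ sc = record
    { pre⊆      = pre⊆
    ; rest⊆     = rest⊆
    ; split     = split
    ; pre<rest  = pre<rest
    ; ascending = ascending
    ; staircase = staircase
    ; sound     = sound′
    ; settled   = λ b∈ adj → covered-mono ≤out′ (settled b∈ adj)
    ; current   = current′ rest current
    }
    where
    open Scan sc
    current′ : ∀ rest → Current pre st lo rest out → Current pre st lo rest out′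
    current′ []      _ = _
    current′ (b ∷ _) p = record
      { lo≤     = lo≤
      ; kept    = kept
      ; pending = λ v j≤b → [ inj₁ ∘ covered-mono ≤out′ , inj₂ ]′ (pending v j≤b)
      }
      where open Pending p

  module _ {pre a st lo b bs out} (sc : Scan pre (a ∷ st) lo (b ∷ bs) out) where
    open Scan sc
    open Pending current

    -- This makes recording `b ∸ a` at level `lo` sound: whatever was read beyond `a` has a label
    -- below `lo`, and nothing unread precedes `b`.
    top-adjacent : lo ≤ s b → Adjacent lo a b
    top-adjacent lo≤b with a∈ , lo≤a , _ , c<lo , _ ← staircase = record
      { left∈   = pre⊆ a∈
      ; right∈  = rest⊆ (here refl)
      ; ≤left   = lo≤a
      ; ≤right  = lo≤b
      ; ordered = pre<rest a∈ (here refl)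
      ; between = λ c∈ a<c c<b → between (split c∈) a<c c<b
      }
      where
      between : ∀ {c} → c ∈ pre ⊎ c ∈ b ∷ bs → a < c → c < b → s c < lo
      between (inj₁ c∈) a<c c<b = let _ , _ , _ , c<lo , _ = staircase in c<lo c∈ a<c
      between (inj₂ (here refl)) _ c<b = contradiction c<b (<-irrefl refl)
      between (inj₂ (there c∈)) _ c<b with b<bs ∷ _ ← ascending =
        contradiction c<b (<-asym (All.lookup b<bs c∈))

    -- The recorded value covers the top at all levels from `lo` on. A deeper element is visible
    -- past `a` only at levels above `s a`.
    below-top : b ∸ a ≤ out lo → ∀ {j x} → Visible pre j x → j ≤ s b →
      Covered out j (b ∸ x) ⊎ (x ∈ st × s a < j)
    below-top recorded v j≤b with pending v j≤b
    ... | inj₁ cov                   = inj₁ cov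
    ... | inj₂ (here refl , lo≤j)  = inj₁ (lo , lo≤j , recorded)
    ... | inj₂ (there x∈st , _) with a∈ , _ , st<a , _ ← staircase =
      inj₂ (x∈st , Visible.hidden v a∈ (All.lookup st<a x∈st))

    -- The top is not visible at levels above `s b`, since these exceed `s a`, and its gaps to `b`
    -- are covered, so it can go. For `b`, the levels up to `s a` are then finished.
    scan-pop : b ∸ a ≤ out lo → s a ≤ s b → Scan pre st (suc (s a)) (b ∷ bs) out
    scan-pop recorded a≤b = record
      { pre⊆      = pre⊆
      ; rest⊆     = rest⊆
      ; split     = split
      ; pre<rest  = pre<rest
      ; ascending = ascending
      ; staircase = let _ , _ , _ , _ , sc′ = staircase in sc′
      ; sound     = sound
      ; settled   = settled
      ; current   = record
        { lo≤     = s≤s a≤b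
        ; kept    = λ v b<j → kept′ v b<j (kept v b<j)
        ; pending = below-top recorded
        }
      }
      where
      kept′ : ∀ {j x} → Visible pre j x → s b < j → x ∈ a ∷ st → x ∈ st
      kept′ v b<j (there x∈)  = x∈
      kept′ v b<j (here refl) = contradiction (≤-trans (Visible.≤label v) a≤b) (<⇒≱ b<j)

    -- The levels left over by `below-top` exceed `s a` and hence `s b`, so no gap ending in `b`
    -- remains uncovered.
    scan-push-< : b ∸ a ≤ out lo → s b < s a → Scan (b ∷ pre) (b ∷ a ∷ st) 0 bs out
    scan-push-< recorded b<a = scan-push sc
      (let _ , _ , _ , _ , sc′ = staircase
       in b<a ∷ All.map (<-trans b<a) (staircase-labels st sc′))
      λ v j≤b → covered j≤b (below-top recorded v j≤b)
      where
      covered : ∀ {j x} → j ≤ s b → Covered out j (b ∸ x) ⊎ (x ∈ st × s a < j) →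
        Covered out j (b ∸ x)
      covered _   (inj₁ cov)       = cov
      covered j≤b (inj₂ (_ , a<j)) = contradiction j≤b (<⇒≱ (<-trans b<a a<j))

-- The program and its invariants

-- Elements start at 1 and array cells at 0.
labelᴱ : Expr → Expr
labelᴱ e = auxᴬ [ e ⊖ lit 1 ]

-- A turn either labels one element, counting down the size of its set in place, or closes a set
-- whose count is 0 and clears its output cell. Empty sets thus need no special case, and the body
-- contains no inner loop.
distribute-body distribute : Cmd
distribute-body =
  ifᶜ (lit 0 ≺ sizesᴬ [ reg 3 ])
    ( auxᴬ [ elemsᴬ [ reg 4 ] ⊖ lit 1 ]≔ reg 3
    ⨟ sizesᴬ [ reg 3 ]≔ sizesᴬ [ reg 3 ] ⊖ lit 1
    ⨟ 4 ≔ lit 1 ⊕ reg 4 )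
    ( outᴬ [ reg 3 ]≔ lit 0
    ⨟ 3 ≔ lit 1 ⊕ reg 3 )
distribute = 3 ≔ lit 0 ⨟ 4 ≔ lit 0 ⨟ while (reg 3 ≺ reg 2) distribute-body

-- Register 3 is the number of elements read, register 4 the height of the
-- stack and register 5 the bound lo. The stack overwrites the cells of the
-- sorted sequence that were already read.
nextᴱ topᴱ : Expr
nextᴱ = sortedᴬ [ reg 3 ]
topᴱ  = sortedᴬ [ reg 4 ⊖ lit 1 ]

push record-gap pop-or-push scan-body scan : Cmd
push = sortedᴬ [ reg 4 ]≔ nextᴱ ⨟ 4 ≔ lit 1 ⊕ reg 4 ⨟ 3 ≔ lit 1 ⊕ reg 3 ⨟ 5 ≔ lit 0
record-gap =
  ifᶜ (outᴬ [ reg 5 ] ≺ nextᴱ ⊖ topᴱ)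
    (outᴬ [ reg 5 ]≔ nextᴱ ⊖ topᴱ)
    skip
pop-or-push =
  -- Adding 1 turns the strict test into `≤`. Popping on equal labels keeps the labels on the stack
  -- strictly monotone.
  ifᶜ (labelᴱ topᴱ ≺ lit 1 ⊕ labelᴱ nextᴱ)
    (5 ≔ lit 1 ⊕ labelᴱ topᴱ ⨟ 4 ≔ reg 4 ⊖ lit 1)
    push
scan-body =
  ifᶜ (lit 0 ≺ reg 4)
    (ifᶜ (reg 5 ≺ lit 1 ⊕ labelᴱ nextᴱ) (record-gap ⨟ pop-or-push) push)
    push
scan = 3 ≔ lit 0 ⨟ 4 ≔ lit 0 ⨟ 5 ≔ lit 0 ⨟ while (reg 3 ≺ reg 1) scan-body

accumulate-body accumulate : Cmd
accumulate-body =
    ifᶜ (reg 4 ≺ outᴬ [ reg 3 ]) (4 ≔ outᴬ [ reg 3 ]) skip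
  ⨟ outᴬ [ reg 3 ]≔ reg 4
  ⨟ 3 ≔ lit 1 ⊕ reg 3
accumulate = 3 ≔ lit 0 ⨟ 4 ≔ lit 0 ⨟ while (reg 3 ≺ reg 2) accumulate-body

program : Cmd
program = distribute ⨟ scan ⨟ accumulate

-- Correctness and running time of the program

module Correctness (I : Instance) {W : ℕ} (fits : suc (n I + m I + k I) ≤ W) where

  open Instance I renaming (n to nᴵ; m to mᴵ; k to kᴵ)

  0≤W : 0 ≤ W
  0≤W = z≤n

  1≤W : 1 ≤ W
  1≤W = ≤-trans (s≤s z≤n) fits

  -- The only sums that the program forms are successors of counters and labels, so no other
  -- overflow has to be excluded.
  ≤m⇒suc≤W : ∀ {i} → i ≤ mᴵ → suc i ≤ W
  ≤m⇒suc≤W i≤m = ≤-trans (s≤s (≤-trans i≤m (≤-trans (m≤n+m mᴵ nᴵ) (m≤m+n _ kᴵ)))) fits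

  ≤k⇒suc≤W : ∀ {i} → i ≤ kᴵ → suc i ≤ W
  ≤k⇒suc≤W i≤k = ≤-trans (s≤s (≤-trans i≤k (m≤n+m kᴵ (nᴵ + mᴵ)))) fits

  inRange′ : All (λ x → 1 ≤ x × x ≤ nᴵ) (concat Xs)
  inRange′ = All.concat⁺ inRange

  positive : ∀ {x} → x ∈ concat Xs → 0 < x
  positive = proj₁ ∘ All.lookup inRange′

  ∸1<n : ∀ {x} → x ∈ concat Xs → x ∸ 1 < nᴵ
  ∸1<n x∈ with All.lookup inRange′ x∈
  ... | s≤s _ , x≤n = x≤n

  ∸1-injective : ∀ {x y} → 0 < x → 0 < y → x ∸ 1 ≡ y ∸ 1 → x ≡ y
  ∸1-injective (s≤s _) (s≤s _) refl = refl

  remaining⇒< : ∀ {i l b} → i + suc l ≡ b → i < b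
  remaining⇒< eq = subst (_ <_) eq (m<m+n _ z<s)

  remaining-step : ∀ {i l b} → i + suc l ≡ b → suc i + l ≡ b
  remaining-step eq = trans (sym (+-suc _ _)) eq

  done⇒≮ : ∀ {i b} → i + 0 ≡ b → ¬ i < b
  done⇒≮ eq i<b = <-irrefl (trans (sym (+-identityʳ _)) eq) i<b

  -- Depending on two registers and the sizes instead of the whole state makes it definitionally
  -- insensitive to all writes of the program.
  record Shape (r₁ r₂ : ℕ) (size : Arr → ℕ) : Set where
    field
      reg-m       : r₁ ≡ mᴵ
      reg-k       : r₂ ≡ kᴵ
      elems-size  : size elemsᴬ ≡ mᴵ
      sizes-size  : size sizesᴬ ≡ kᴵ
      sorted-size : size sortedᴬ ≡ mᴵ
      aux-size    : size auxᴬ ≡ nᴵ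
      out-size    : size outᴬ ≡ kᴵ

  ShapeOf : State → Set
  ShapeOf σ = Shape (regs σ 1) (regs σ 2) (size σ)

  labelOf : State → ℕ → ℕ
  labelOf σ x = cell σ auxᴬ (x ∸ 1)

  -- First loop: writing the labels

  target : ℕ → ℕ
  target = label 0 Xs

  -- `Zs` is the unread rest of the current set followed by the later sets; its head shrinks with
  -- every element read.
  record Distributing (Zs : List (List ℕ)) (σ : State) : Set where
    field
      shape     : ShapeOf σ
      sets-left : regs σ 3 + length Zs ≡ kᴵ
      left      : regs σ 4 + length (concat Zs) ≡ mᴵ
      elements  : Segment (cell σ elemsᴬ) (regs σ 4) (concat Zs)
      counts    : Segment (cell σ sizesᴬ) (regs σ 3) (map length Zs)
      input     : Segment (cell σ sortedᴬ) 0 sorted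
      suffix    : ∀ {x} → x ∈ concat Zs → x ∈ concat Xs
      labels    : Labelled target (regs σ 3) Zs
      processed : ∀ {x} → x ∈ concat Xs → x ∈ concat Zs ⊎ labelOf σ x ≡ target x
      cleared   : ∀ {j} → j < regs σ 3 → cell σ outᴬ j ≡ 0

  record Distributed (σ : State) : Set where
    field
      shape    : ShapeOf σ
      input    : Segment (cell σ sortedᴬ) 0 sorted
      labelled : Labelled (labelOf σ) 0 Xs
      cleared  : ∀ {j} → j < kᴵ → cell σ outᴬ j ≡ 0

  DistributeInv : ℕ → State → Set
  DistributeInv μ σ = ∃[ Zs ] μ ≡ length Zs + length (concat Zs) × Distributing Zs σ

  distribute-end : ∀ {σ} → Distributing [] σ → Distributed σ
  distribute-end d = record
    { shape    = shape
    ; input    = input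
    ; labelled = labelled-cong 0 Xs (λ x∈ → [ (λ ()) , (λ eq → eq) ]′ (processed x∈))
        (label-labelled 0 disjoint)
    ; cleared  = λ j<k → cleared (subst (_ <_) (trans (sym sets-left) (+-identityʳ _)) j<k)
    }
    where open Distributing d

  distribute-set : ∀ {Zs σ} → Distributing ([] ∷ Zs) σ →
    Runs W 0 distribute-body (DistributeInv (length Zs + length (concat Zs))) σ
  distribute-set {Zs} {σ} d with eq ∷ counts′ ← Distributing.counts d =
    run-else (0≤W , _ , subst (regs σ 3 <_) (sym sizes-size) j<k) (λ 0<c → <-irrefl (sym eq) 0<c)
      (run-seq (run-store _ 0≤W (subst (regs σ 3 <_) (sym out-size) j<k)
        (run-assign (1≤W , _ , ≤k⇒suc≤W (<⇒≤ j<k)) (Zs , refl , record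
          { shape     = record { Shape shape }
          ; sets-left = remaining-step sets-left
          ; left      = left
          ; elements  = elements
          ; counts    = counts′
          ; input     = input
          ; suffix    = suffix
          ; labels    = proj₂ labels
          ; processed = processed
          ; cleared   = cleared′
          }))))
    where
    open Distributing d
    open Shape shape
    j<k : regs σ 3 < kᴵ
    j<k = remaining⇒< sets-left
    cleared′ : ∀ {j} → j < suc (regs σ 3) → update (cell σ outᴬ) (regs σ 3) 0 j ≡ 0
    cleared′ (s≤s j≤) with m≤n⇒m<n∨m≡n j≤
    ... | inj₁ j<   = trans (update-≢ (cell σ outᴬ) 0 (>⇒≢ j<)) (cleared j<)
    ... | inj₂ refl = update-≡ (cell σ outᴬ) (regs σ 3) 0

  distribute-element : ∀ {z Z Zs σ} → Distributing ((z ∷ Z) ∷ Zs) σ →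
    Runs W 0 distribute-body (DistributeInv (length Zs + suc (length (Z ++ concat Zs)))) σ
  distribute-element {Z = Z} {Zs} {σ} d
    with refl ∷ elements′ ← Distributing.elements d
       | eq ∷ counts′ ← Distributing.counts d =
    run-then (0≤W , _ , j<sizes) (subst (0 <_) (sym eq) z<s)
      (run-seq (run-store ((_ , p<elems) , 1≤W) _ (subst (z ∸ 1 <_) (sym aux-size) (∸1<n z∈))
        (run-seq (run-store _ ((_ , j<sizes) , 1≤W) j<sizes
          (run-assign (1≤W , _ , ≤m⇒suc≤W (<⇒≤ p<m)) (Z ∷ Zs , +-suc (length Zs) _ , record
            { shape     = record { Shape shape }
            ; sets-left = sets-left
            ; left      = remaining-step left
            ; elements  = elements′
            ; counts    =
                trans (update-≡ (cell σ sizesᴬ) (regs σ 3) _) (cong (_∸ 1) eq) ∷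
                segment-update ≤-refl counts′
            ; input     = input
            ; suffix    = suffix ∘ there
            ; labels    = All.tail (proj₁ labels) , proj₂ labels
            ; processed = λ x∈ → processed′ x∈ (processed x∈)
            ; cleared   = cleared
            }))))))
    where
    open Distributing d
    open Shape shape
    z : ℕ
    z = cell σ elemsᴬ (regs σ 4)
    z∈ : z ∈ concat Xs
    z∈ = suffix (here refl)
    j<sizes : regs σ 3 < size σ sizesᴬ
    j<sizes = subst (regs σ 3 <_) (sym sizes-size) (remaining⇒< sets-left)
    p<m : regs σ 4 < mᴵ
    p<m = remaining⇒< left
    p<elems : regs σ 4 < size σ elemsᴬ
    p<elems = subst (regs σ 4 <_) (sym elems-size) p<m
    labelled-z : update (cell σ auxᴬ) (z ∸ 1) (regs σ 3) (z ∸ 1) ≡ target z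
    labelled-z = trans (update-≡ (cell σ auxᴬ) (z ∸ 1) _) (sym (All.head (proj₁ labels)))
    processed′ : ∀ {x} → x ∈ concat Xs →
      x ∈ z ∷ Z ++ concat Zs ⊎ labelOf σ x ≡ target x →
      x ∈ Z ++ concat Zs ⊎ update (cell σ auxᴬ) (z ∸ 1) (regs σ 3) (x ∸ 1) ≡ target x
    processed′ x∈ (inj₁ (there x∈Zs)) = inj₁ x∈Zs
    processed′ x∈ (inj₁ (here refl)) = inj₂ labelled-z
    -- Elements are positive, so `∸ 1` sends different ones to different cells and the write spares
    -- the other labels.
    processed′ {x} x∈ (inj₂ lx) with z ≟ x
    ... | no z≢x   = inj₂ (trans
      (update-≢ (cell σ auxᴬ) _ (z≢x ∘ ∸1-injective (positive z∈) (positive x∈))) lx)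
    ... | yes refl = inj₂ labelled-z

  distribute-turn : ∀ {μ σ} → DistributeInv μ σ →
    Turn W (reg 3 ≺ reg 2) distribute-body DistributeInv Distributed μ σ
  distribute-turn {σ = σ} ([] , refl , d) =
    stop _ (subst (λ b → ¬ regs σ 3 < b) (sym reg-k) (done⇒≮ sets-left)) (distribute-end d)
    where
    open Distributing d
    open Shape shape
  distribute-turn {σ = σ} ((Z ∷ Zs) , refl , d) =
    next _ (subst (regs σ 3 <_) (sym reg-k) (remaining⇒< sets-left)) (body Z d)
    where
    open Distributing d
    open Shape shape
    body : ∀ Z → Distributing (Z ∷ Zs) σ →
      Runs W 0 distribute-body (DistributeInv (length Zs + length (concat (Z ∷ Zs)))) σ
    body []      = distribute-set
    body (_ ∷ _) = distribute-element

  run-distribute : ∀ {σ} → Initial I σ → Runs W (2 * (mᴵ ⊔ kᴵ)) distribute Distributed σ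
  run-distribute init =
    run-seq (run-assign 0≤W (run-seq (run-assign 0≤W
      (run-while DistributeInv distribute-turn measure≤ (Xs , refl , record
        { shape     = record
          { reg-m       = reg-m
          ; reg-k       = reg-k
          ; elems-size  = proj₁ in-elems
          ; sizes-size  = trans (proj₁ in-sizes) (length-map length Xs)
          ; sorted-size = trans (proj₁ in-sorted) (↭-length sorted-↭)
          ; aux-size    = aux-size
          ; out-size    = out-size
          }
        ; sets-left = refl
        ; left      = refl
        ; elements  = lookup⇒segment _ 0 _ (proj₂ in-elems)
        ; counts    = lookup⇒segment _ 0 _ (proj₂ in-sizes)
        ; input     = lookup⇒segment _ 0 _ (proj₂ in-sorted)
        ; suffix    = λ x∈ → x∈
        ; labels    = label-labelled 0 disjoint
        ; processed = inj₁
        ; cleared   = λ ()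
        })))))
    where
    open Initial init
    -- There are `k` closing turns and `m` labelling turns.
    measure≤ : kᴵ + mᴵ ≤ 2 * (mᴵ ⊔ kᴵ)
    measure≤ = +-mono-≤ (m≤n⊔m mᴵ kᴵ) (≤-trans (m≤m⊔n mᴵ kᴵ) (m≤m+n _ 0))

  -- Second loop: recording the gaps

  record Scanning (pre st rest : List ℕ) (σ : State) : Set where
    field
      shape    : ShapeOf σ
      left     : regs σ 3 + length rest ≡ mᴵ
      -- This keeps the stack clear of the unread input in the same array.
      top≤     : regs σ 4 ≤ regs σ 3
      input    : Segment (cell σ sortedᴬ) (regs σ 3) rest
      stack    : Stack (cell σ sortedᴬ) (regs σ 4) st
      labelled : Labelled (labelOf σ) 0 Xs
      scanned  : Gaps.Scan Xs (labelOf σ) pre st (regs σ 5) rest (cell σ outᴬ)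

  record Scanned (σ : State) : Set where
    field
      shape  : ShapeOf σ
      prefix : ∀ {i} → i < kᴵ → prefixMax (cell σ outᴬ) (suc i) ≡ Δ Xs i

  -- Each element is read once and pushed at most once, so every turn of the
  -- loop decreases the measure by one.
  ScanInv : ℕ → State → Set
  ScanInv μ σ = ∃[ pre ] ∃[ st ] ∃[ rest ]
    μ ≡ length rest + (length rest + length st) × Scanning pre st rest σ

  module Reading {pre st b bs σ} (d : Scanning pre st (b ∷ bs) σ) where
    open Scanning d public
    open Shape shape public
    open Gaps.Scan scanned public

    i<m : regs σ 3 < mᴵ
    i<m = remaining⇒< left

    i<sorted : regs σ 3 < size σ sortedᴬ
    i<sorted = subst (regs σ 3 <_) (sym sorted-size) i<m

    top∸1<sorted : regs σ 4 ∸ 1 < size σ sortedᴬ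
    top∸1<sorted = ≤-<-trans (m∸n≤m _ 1) (≤-<-trans top≤ i<sorted)

    b∈ : b ∈ concat Xs
    b∈ = rest⊆ (here refl)

    label<k : ∀ {x} → x ∈ concat Xs → labelOf σ x < kᴵ
    label<k = labelled-< 0 Xs labelled

    lab<aux : ∀ {x} → x ∈ concat Xs → x ∸ 1 < size σ auxᴬ
    lab<aux x∈ = subst (_ <_) (sym aux-size) (∸1<n x∈)

  run-push : ∀ {pre st b bs σ} → Scanning pre st (b ∷ bs) σ →
    Gaps.Scan Xs (labelOf σ) (b ∷ pre) (b ∷ st) 0 bs (cell σ outᴬ) →
    Runs W 0 push (ScanInv (length bs + suc (length bs + length st))) σ
  run-push {pre} {st} {b} {bs} {σ} d scanned′ with refl ∷ input′ ← Scanning.input d =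
    run-seq (run-store _ (_ , i<sorted) (≤-<-trans top≤ i<sorted)
      (run-seq (run-assign (1≤W , _ , ≤m⇒suc≤W (<⇒≤ (≤-<-trans top≤ i<m)))
        (run-seq (run-assign (1≤W , _ , ≤m⇒suc≤W (<⇒≤ i<m))
          (run-assign 0≤W (b ∷ pre , b ∷ st , bs ,
            cong (length bs +_) (sym (+-suc (length bs) (length st))) , record
            { shape    = record { Shape shape }
            ; left     = remaining-step left
            ; top≤     = s≤s top≤
            -- If the stack is as high as the reading position, `b` is written back to its own cell;
            -- only the cells after it must survive.
            ; input    = segment-update (s≤s top≤) input′
            ; stack    = z<s , update-≡ (cell σ sortedᴬ) (regs σ 4) b , stack-update st ≤-refl stack
            ; labelled = labelled
            ; scanned  = scanned′
            })))))))
    where open Reading d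

  Recorded : List ℕ → ℕ → List ℕ → ℕ → List ℕ → State → Set
  Recorded pre a st b bs σ =
    Scanning pre (a ∷ st) (b ∷ bs) σ × b ∸ a ≤ cell σ outᴬ (regs σ 5)

  run-record-gap : ∀ {pre a st b bs σ} → Scanning pre (a ∷ st) (b ∷ bs) σ →
    regs σ 5 ≤ labelOf σ b → Runs W 0 record-gap (Recorded pre a st b bs) σ
  run-record-gap {pre} {a} {st} {b} {bs} {σ} d lo≤b
    with refl ∷ _ ← Scanning.input d | _ , refl , _ ← Scanning.stack d =
    branch (out lo <? b ∸ a)
    where
    open Reading d
    open Gaps Xs (labelOf σ)
    out = cell σ outᴬ
    lo = regs σ 5
    -- The level is at most the label of `b`, so it indexes an output cell.
    lo<out : lo < size σ outᴬ
    lo<out = subst (lo <_) (sym out-size) (≤-<-trans lo≤b (label<k b∈))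
    safe-gap : Safe W (nextᴱ ⊖ topᴱ) σ
    safe-gap = (_ , i<sorted) , (_ , 1≤W) , top∸1<sorted
    ≤out′ : out lo < b ∸ a → ∀ j → out j ≤ update out lo (b ∸ a) j
    ≤out′ out< j with lo ≟ j
    ... | yes refl = ≤-trans (<⇒≤ out<) (≤-reflexive (sym (update-≡ out lo _)))
    ... | no lo≢j  = ≤-reflexive (sym (update-≢ out _ lo≢j))
    sound′ : ∀ {j} → j < length Xs → update out lo (b ∸ a) j ≤ maxgap (Y j)
    sound′ {j} j<k with lo ≟ j
    ... | yes refl = ≤-trans (≤-reflexive (update-≡ out lo _))
      (adjacent⇒≤maxgap labelled (top-adjacent scanned lo≤b))
    ... | no lo≢j  = ≤-trans (≤-reflexive (update-≢ out _ lo≢j)) (sound j<k)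
    branch : Dec (out lo < b ∸ a) → Runs W 0 record-gap (Recorded pre a st b bs) σ
    branch (no out≮)  = run-else ((_ , lo<out) , safe-gap) out≮ (run-skip (d , ≮⇒≥ out≮))
    branch (yes out<) = run-then ((_ , lo<out) , safe-gap) out<
      (run-store _ safe-gap lo<out (record
        { shape    = record { Shape shape }
        ; left     = left
        ; top≤     = top≤
        ; input    = input
        ; stack    = stack
        ; labelled = labelled
        ; scanned  = scan-record (≤out′ out<) sound′ scanned
        } , ≤-reflexive (sym (update-≡ out lo (b ∸ a)))))

  run-pop-or-push : ∀ {pre a st b bs σ} → Recorded pre a st b bs σ →
    Runs W 0 pop-or-push (ScanInv (length bs + suc (length bs + suc (length st)))) σ
  run-pop-or-push {pre} {a} {st} {b} {bs} {σ} (d , recorded)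
    with refl ∷ _ ← Scanning.input d | _ , refl , stack′ ← Scanning.stack d =
    branch (labelOf σ a <? suc (labelOf σ b))
    where
    open Reading d
    a∈ : a ∈ concat Xs
    a∈ = pre⊆ (proj₁ staircase)
    safe-label : Safe W (labelᴱ topᴱ) σ
    safe-label = (((_ , 1≤W) , top∸1<sorted) , 1≤W) , lab<aux a∈
    safe : Safeᵗ W (labelᴱ topᴱ ≺ lit 1 ⊕ labelᴱ nextᴱ) σ
    safe = safe-label ,
      1≤W , (((_ , i<sorted) , 1≤W) , lab<aux b∈) , ≤k⇒suc≤W (<⇒≤ (label<k b∈))
    measure : length bs + suc (length bs + suc (length st)) ≡
              suc (length bs + suc (length bs + length st))
    measure = trans (cong (λ l → length bs + suc l) (+-suc (length bs) (length st))) (+-suc _ _)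
    branch : Dec (labelOf σ a < suc (labelOf σ b)) →
      Runs W 0 pop-or-push (ScanInv (length bs + suc (length bs + suc (length st)))) σ
    branch (no a≰b)  = run-else safe a≰b
      (run-push d (Gaps.scan-push-< Xs (labelOf σ) scanned recorded (≮⇒≥ a≰b)))
    branch (yes a≤b) = run-then safe a≤b
      (run-seq (run-assign (1≤W , safe-label , ≤k⇒suc≤W (<⇒≤ (label<k a∈)))
        (run-assign (_ , 1≤W) (pre , st , b ∷ bs , measure , record
          { shape    = record { Shape shape }
          ; left     = left
          ; top≤     = ≤-trans (m∸n≤m _ 1) top≤
          ; input    = input
          ; stack    = stack′
          ; labelled = labelled
          ; scanned  = Gaps.scan-pop Xs (labelOf σ) scanned recorded (≤-pred a≤b)
          }))))

  run-scan-body : ∀ {pre b bs σ} st → Scanning pre st (b ∷ bs) σ →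
    Runs W 0 scan-body (ScanInv (length bs + suc (length bs + length st))) σ
  run-scan-body {σ = σ} [] d =
    run-else (0≤W , _) (λ 0<sp → <-irrefl (sym stack) 0<sp)
      (run-push d (Gaps.scan-push-[] Xs (labelOf σ) scanned))
    where open Scanning d
  run-scan-body {b = b} {bs} {σ} (a ∷ st) d with refl ∷ _ ← Scanning.input d =
    run-then (0≤W , _) (proj₁ stack) (branch (regs σ 5 <? suc (labelOf σ b)))
    where
    open Reading d
    safe : Safeᵗ W (reg 5 ≺ lit 1 ⊕ labelᴱ nextᴱ) σ
    safe = _ , 1≤W , (((_ , i<sorted) , 1≤W) , lab<aux b∈) , ≤k⇒suc≤W (<⇒≤ (label<k b∈))
    branch : Dec (regs σ 5 < suc (labelOf σ b)) →
      Runs W 0 (ifᶜ (reg 5 ≺ lit 1 ⊕ labelᴱ nextᴱ) (record-gap ⨟ pop-or-push) push)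
        (ScanInv (length bs + suc (length bs + suc (length st)))) σ
    branch (no lo≰b)  = run-else safe lo≰b
      (run-push d (Gaps.scan-push-lo Xs (labelOf σ) scanned (≮⇒≥ lo≰b)))
    branch (yes lo≤b) = run-then safe lo≤b
      (run-seq (weaken run-pop-or-push (run-record-gap d (≤-pred lo≤b))))

  -- With no element left, the right end of every adjacent pair has been read, so `settled` applies
  -- to all of them.
  scan-end : ∀ {pre st σ} → Scanning pre st [] σ → Scanned σ
  scan-end {pre} {σ = σ} d = record
    { shape  = shape
    ; prefix = λ i<k → prefixMax≡Δ labelled (λ j≤i → sound (≤-<-trans j≤i i<k))
        λ adj → settled ([ (λ b∈ → b∈) , (λ ()) ]′ (split (Adjacent.right∈ adj))) adj
    }
    where
    open Scanning d
    open Gaps Xs (labelOf σ)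
    open Scan scanned

  scan-turn : ∀ {μ σ} → ScanInv μ σ → Turn W (reg 3 ≺ reg 1) scan-body ScanInv Scanned μ σ
  scan-turn {σ = σ} (pre , st , [] , refl , d) =
    stop _ (subst (λ b → ¬ regs σ 3 < b) (sym reg-m) (done⇒≮ left)) (scan-end d)
    where
    open Scanning d
    open Shape shape
  scan-turn {σ = σ} (pre , st , b ∷ bs , refl , d) =
    next _ (subst (regs σ 3 <_) (sym reg-m) i<m) (run-scan-body st d)
    where open Reading d

  run-scan : ∀ {σ} → Distributed σ → Runs W (2 * (mᴵ ⊔ kᴵ)) scan Scanned σ
  run-scan d = run-seq (run-assign 0≤W (run-seq (run-assign 0≤W (run-seq (run-assign 0≤W
    (run-while ScanInv scan-turn measure≤ ([] , [] , sorted , refl , record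
      { shape    = record { Shape shape }
      ; left     = ↭-length sorted-↭
      ; top≤     = z≤n
      ; input    = input
      ; stack    = refl
      ; labelled = labelled
      ; scanned  = Gaps.scan-start Xs _ (∈-resp-↭ sorted-↭) (∈-resp-↭ (↭-sym sorted-↭))
          (Linked⇒AllPairs <-trans sorted-strict) cleared
      })))))))
    where
    open Distributed d
    sorted≤ : length sorted ≤ mᴵ ⊔ kᴵ
    sorted≤ = ≤-trans (≤-reflexive (↭-length sorted-↭)) (m≤m⊔n mᴵ kᴵ)
    measure≤ : length sorted + (length sorted + 0) ≤ 2 * (mᴵ ⊔ kᴵ)
    measure≤ = *-monoʳ-≤ 2 sorted≤

  -- Third loop: prefix maxima

  record Accumulating (f : ℕ → ℕ) (i : ℕ) (σ : State) : Set where
    field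
      shape   : ShapeOf σ
      current : regs σ 4 ≡ prefixMax f i
      filled  : ∀ {j} → j < regs σ 3 → cell σ outᴬ j ≡ prefixMax f (suc j)
      todo    : ∀ {j} → i ≤ j → cell σ outᴬ j ≡ f j

  -- `Accumulating` has its own index because the maximum is taken before it is stored: in between,
  -- the index is one ahead of register 3. At the head of the loop the two agree.
  AccumulateInv : (ℕ → ℕ) → ℕ → State → Set
  AccumulateInv f μ σ = regs σ 3 + μ ≡ kᴵ × Accumulating f (regs σ 3) σ

  Accumulated : (ℕ → ℕ) → State → Set
  Accumulated f σ = ShapeOf σ × (∀ {j} → j < kᴵ → cell σ outᴬ j ≡ prefixMax f (suc j))

  run-maximum : ∀ {f σ} → regs σ 3 < kᴵ → Accumulating f (regs σ 3) σ →
    Runs W 0 (ifᶜ (reg 4 ≺ outᴬ [ reg 3 ]) (4 ≔ outᴬ [ reg 3 ]) skip)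
      (λ τ → regs τ 3 ≡ regs σ 3 × Accumulating f (suc (regs τ 3)) τ) σ
  run-maximum {f} {σ} i<k d = branch (regs σ 4 <? cell σ outᴬ (regs σ 3))
    where
    open Accumulating d
    i<out : regs σ 3 < size σ outᴬ
    i<out = subst (regs σ 3 <_) (sym (Shape.out-size shape)) i<k
    branch : Dec (regs σ 4 < cell σ outᴬ (regs σ 3)) → Runs W 0 _ _ σ
    branch (yes cur<) = run-then (_ , _ , i<out) cur< (run-assign (_ , i<out) (refl , record
      { shape   = record { Shape shape }
      ; current = trans (sym (m≤n⇒m⊔n≡n (<⇒≤ cur<))) (cong₂ _⊔_ current (todo ≤-refl))
      ; filled  = filled
      ; todo    = todo ∘ <⇒≤
      }))
    branch (no cur≮)  = run-else (_ , _ , i<out) cur≮ (run-skip (refl , record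
      { shape   = shape
      ; current = trans (sym (m≥n⇒m⊔n≡m (≮⇒≥ cur≮))) (cong₂ _⊔_ current (todo ≤-refl))
      ; filled  = filled
      ; todo    = todo ∘ <⇒≤
      }))

  run-fill : ∀ {f μ σ} → regs σ 3 + suc μ ≡ kᴵ → Accumulating f (suc (regs σ 3)) σ →
    Runs W 0 (outᴬ [ reg 3 ]≔ reg 4 ⨟ 3 ≔ lit 1 ⊕ reg 3) (AccumulateInv f μ) σ
  run-fill {f} {μ} {σ} left d =
    run-seq (run-store _ _ (subst (regs σ 3 <_) (sym out-size) i<k)
      (run-assign (1≤W , _ , ≤k⇒suc≤W (<⇒≤ i<k)) (remaining-step left , record
        { shape   = record { Shape shape }
        ; current = current
        ; filled  = filled′
        ; todo    = λ i<j → trans (update-≢ (cell σ outᴬ) _ (<⇒≢ i<j)) (todo i<j)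
        })))
    where
    open Accumulating d
    open Shape shape
    i<k : regs σ 3 < kᴵ
    i<k = remaining⇒< left
    filled′ : ∀ {j} → j < suc (regs σ 3) →
      update (cell σ outᴬ) (regs σ 3) (regs σ 4) j ≡ prefixMax f (suc j)
    filled′ (s≤s j≤i) with m≤n⇒m<n∨m≡n j≤i
    ... | inj₁ j<i  = trans (update-≢ (cell σ outᴬ) _ (>⇒≢ j<i)) (filled j<i)
    ... | inj₂ refl = trans (update-≡ (cell σ outᴬ) (regs σ 3) _) current

  run-accumulate-body : ∀ {f μ σ} → AccumulateInv f (suc μ) σ →
    Runs W 0 accumulate-body (AccumulateInv f μ) σ
  run-accumulate-body {μ = μ} (left , d) = run-seq (weaken
    (λ (i≡ , d′) → run-fill (trans (cong (_+ suc μ) i≡) left) d′)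
    (run-maximum (remaining⇒< left) d))

  accumulate-turn : ∀ {f μ σ} → AccumulateInv f μ σ →
    Turn W (reg 3 ≺ reg 2) accumulate-body (AccumulateInv f) (Accumulated f) μ σ
  accumulate-turn {μ = zero} {σ} (left , d) =
    stop _ (subst (λ b → ¬ regs σ 3 < b) (sym reg-k) (done⇒≮ left))
      (shape , λ j<k → filled (subst (_ <_) (trans (sym left) (+-identityʳ _)) j<k))
    where
    open Accumulating d
    open Shape shape
  accumulate-turn {μ = suc μ} {σ} inv@(left , d) =
    next _ (subst (regs σ 3 <_) (sym reg-k) (remaining⇒< left)) (run-accumulate-body inv)
    where
    open Accumulating d
    open Shape shape

  run-accumulate : ∀ {σ} → Scanned σ → Runs W (2 * (mᴵ ⊔ kᴵ)) accumulate (Output I) σ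
  run-accumulate {σ} d = run-seq (run-assign 0≤W (run-seq (run-assign 0≤W
    -- The reference `f` is the output array as the scan leaves it.
    (weaken (λ {τ} → output {τ}) (run-while (AccumulateInv (cell σ outᴬ)) accumulate-turn
      (≤-trans (m≤n⊔m mᴵ kᴵ) (m≤m+n _ _)) (refl , record
        { shape   = record { Shape shape }
        ; current = refl
        ; filled  = λ ()
        ; todo    = λ _ → refl
        }))))))
    where
    open Scanned d
    output : ∀ {τ} → Accumulated (cell σ outᴬ) τ → Output I τ
    output {τ} (shape′ , filled) = subst (Holds τ outᴬ) (sym (map-upTo (Δ Xs) kᴵ))
      (trans (Shape.out-size shape′) (sym length≡k) , λ i →
        let i<k = subst (toℕ i <_) length≡k (toℕ<n i)
        in trans (filled i<k) (trans (prefix i<k) (sym (lookup-applyUpTo (Δ Xs) kᴵ i))))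
      where
      length≡k : length (applyUpTo (Δ Xs) kᴵ) ≡ kᴵ
      length≡k = length-applyUpTo (Δ Xs) kᴵ

  run-program : ∀ {σ} → Initial I σ → Runs W (2 * (mᴵ ⊔ kᴵ)) program (Output I) σ
  run-program init = run-seq (weaken (run-seq ∘ weaken run-accumulate ∘ run-scan) (run-distribute init))

theorem7 : ∃[ P ] ∃[ c ]
    ∀ (I : Instance) (W : ℕ) (σ : State) →
    c * suc (n I + m I + k I) ≤ W →
    Initial I σ →
    ∃[ t ] ∃[ σ′ ]
    (W ⊢ P ∶ σ ⇓[ t ] σ′)
    × t ≤ c * suc (m I ⊔ k I)
    × Output I σ′
-- Every loop turns at most `2 * (m I ⊔ k I)` times; doubling `steps program` absorbs this factor 2.
-- As the constant is positive, the assumption on `W` leaves room for `suc (n I + m I + k I)`.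
theorem7 = program , 2 * steps program , λ I W σ c*size≤W init →
  let runs d t≤ out = Correctness.run-program I
        (≤-trans (m≤n*m (suc (n I + m I + k I)) (2 * steps program)) c*size≤W) init
  in _ , _ , d , ≤-trans t≤ (linear (steps program) (m I ⊔ k I)) , out
  where
  linear : ∀ K M → K * suc (2 * M) ≤ 2 * K * suc M
  linear K M = ≤-trans (*-monoʳ-≤ K (≤-trans (n≤1+n _) (≤-reflexive (sym (*-suc 2 M)))))
    (≤-reflexive (trans (sym (*-assoc K 2 (suc M))) (cong (_* suc M) (*-comm K 2))))
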